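{- $\mathrm{Gr}(2) \le \mathrm{TTT}(4,2,6) + 1$.
   Context: For a finite alphabet $A$ with $|A|\ge 2$ and a group $G$ acting on $A$, a $k$-parameter subset of $A^n$ is the image of an injective map $f : A^k \to A^n$ such that for each coordinate $1 \le i \le n$, either $f_i(x_1,\dots,x_k) = a$ for some constant $a \in A$, or $f_i(x_1,\dots,x_k) = \sigma(x_j)$ for some $1\le j\le k$ and some $\sigma \in G$. Tic-tac-toe numbers: take $A = [t] = \{1,\dots,t\}$ and $G = \{e,\pi\}$ with $e(x)=x$, $\pi(x) = t+1-x$. A $d$-parameter subset of $[t]^n$ for this $G$ is a $d$-dimensional tic-tac-toe space. $\mathrm{TTT}(t,k,d)$ is the least $n$ such that every $k$-coloring of the points of $[t]^n$ contains a monochromatic $d$-dimensional tic-tac-toe space. Graham numbers: take $A = \{\pm 1\}$ and $G = \{x\mapsto x, x \mapsto -x\}$; a $d$-parameter subset of $\{\pm1\}^n$ is a $d$-dimensional subcube. An edge-coloring of $\{\pm1\}^n$ is a $2$-coloring of the edges of the complete graph on $\{\pm1\}^n$. $\mathrm{Gr}(d)$ is the least $n$ such that every edge-coloring of $\{\pm1\}^n$ contains a $d$-dimensional subcube all of whose pairs of points receive the same color. In particular $\mathrm{Gr}(2)$ is the least $n$ such that every edge-coloring of $\{\pm1\}^n$ contains four coplanar points forming a $2$-dimensional subcube with all $6$ edges between them of one color. -}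

module Defs where

open import Data.Nat using (ℕ; _≤_)
open import Data.Fin using (Fin; opposite)
open import Data.Bool using (Bool; true; false; not)
open import Data.Vec using (Vec; lookup; tabulate)
open import Data.Product using (Σ; _×_; ∃)
open import Relation.Binary.PropositionalEquality using (_≡_; _≢_)

-- Specification of one coordinate of a k-parameter map A^k → A^n:
-- either a constant a, or σ(x_j) for a group element σ (of index type Gr).
data CoordSpec (A Gr : Set) (k : ℕ) : Set where
  const : A → CoordSpec A Gr k
  var   : Fin k → Gr → CoordSpec A Gr k

evalCoord : {A Gr : Set} {k : ℕ} → (Gr → A → A) → CoordSpec A Gr k → Vec A k → A
evalCoord act (const a) x = a
evalCoord act (var j σ) x = act σ (lookup x j)

embed : {A Gr : Set} {k n : ℕ} → (Gr → A → A) → (Fin n → CoordSpec A Gr k) → Vec A k → Vec A n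
embed act s x = tabulate (λ i → evalCoord act (s i) x)

IsParamMap : {A Gr : Set} {k n : ℕ} → (Gr → A → A) → (Fin n → CoordSpec A Gr k) → Set
IsParamMap act s = ∀ x y → embed act s x ≡ embed act s y → x ≡ y

IsLeast : (ℕ → Set) → ℕ → Set
IsLeast P n = P n × (∀ m → P m → n ≤ m)

-- Tic-tac-toe: A = [t] (as Fin t), G = {e, π}, π x = t+1-x
-- (with 0-indexed Fin this is `opposite`, i ↦ t-1-i).

tttAct : (t : ℕ) → Bool → Fin t → Fin t
tttAct t false x = x
tttAct t true  x = opposite x

TTTProp : (t k d : ℕ) → ℕ → Set
TTTProp t k d n =
  (c : Vec (Fin t) n → Fin k) →
  Σ (Fin n → CoordSpec (Fin t) Bool d) λ s →
    IsParamMap (tttAct t) s ×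
    ∃ λ (col : Fin k) → ∀ x → c (embed (tttAct t) s x) ≡ col

-- Graham: A = {±1} (as Bool), G = {x ↦ x, x ↦ -x} (negation = not).

grAct : Bool → Bool → Bool
grAct false x = x
grAct true  x = not x

-- An edge-colouring of the complete graph on {±1}^n is represented as a
-- symmetric colouring c of ordered pairs (only pairs of distinct points matter).

GrProp : (d : ℕ) → ℕ → Set
GrProp d n =
  (c : Vec Bool n → Vec Bool n → Fin 2) → (∀ u v → c u v ≡ c v u) →
  Σ (Fin n → CoordSpec Bool Bool d) λ s →
    IsParamMap grAct s ×
    ∃ λ (col : Fin 2) →
      ∀ x y → x ≢ y → c (embed grAct s x) (embed grAct s y) ≡ col

{-# OPTIONS --safe #-}
-- Identify [4] with {±1}², π being negation of both entries, so that a point of [4]ⁿ is an edge from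
-- (1, u) to (-1, v) in {±1}ⁿ⁺¹.  A monochromatic, say red, tic-tac-toe space of dimension 6 is then a
-- pair of parallel 6-cubes, top and bottom, with all edges between them red.  Up to sign, a nonzero
-- p ∈ {0, ±1}⁶ names the class of the edges of such a cube that join a point to the one obtained by
-- flipping the support of p, with sign pattern ±p there.  If a class contains a red edge at the top and
-- one at the bottom, these two edges span a red square.  Otherwise colour p red if there is a red edge at
-- the top and blue if not: when p, q, p + q, p - q (p, q with disjoint supports) get the same colour, some
-- square in one of the cubes has no red edge.  So it is enough that no 2-colouring of {0, ±1}⁶ up to sign
-- avoids these monochromatic "lines", and this is established by a verified DPLL search, made small by
-- lemmas that are transported along signed coordinate substitutions:
--   * among 5 disjoint vectors, the colours of the vectors do not split 3 : 2;
--   * if 4 of them are red and p is blue, then p + q and p - q are not both blue for any red q;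
--   * hence all 6 unit vectors have one colour, say red, and one shows by downward induction on k that
--     the vectors e₀ + e₁, …, e₀ + eₖ cannot all be red; k = 0 is a contradiction.
module Submission where

open import Defs
open import Data.Nat using (ℕ; _≤_; _+_)
open import Data.Nat.Base using (zero; suc)
open import Data.Nat.DivMod using (_/_; _%_)
open import Data.Nat.Properties using (+-comm)
open import Data.Fin using (Fin; zero; suc; toℕ)
open import Data.Fin.Patterns using (0F; 1F; 2F; 3F; 4F; 5F)
import Data.Fin.Properties as Fin
open import Data.Bool using (Bool; true; false; not; if_then_else_)
import Data.Bool.Properties as Bool
open import Data.Maybe using (Maybe; just; nothing; is-just; _>>=_)
open import Data.Maybe.Properties using (just-injective)
open import Data.Maybe.Relation.Unary.Any using (Any; just)
open import Data.Vec as Vec using (Vec; []; _∷_; lookup; map; tabulate; zipWith; replicate; _[_]≔_)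
open import Data.Vec.Properties using
  (map-∘; map-cong; lookup-map; lookup∘tabulate; tabulate∘lookup; tabulate-cong; tabulate-∘;
   lookup-zipWith; lookup∘update; lookup∘update′; lookup-replicate)
open import Data.List as List using (List; []; _∷_; _++_; filter; foldr)
open import Data.List.Membership.Propositional using (_∈_; find)
open import Data.List.Relation.Unary.All as All using (All; []; _∷_)
open import Data.List.Relation.Unary.All.Properties using (++⁺; map⁺; map⁻; all-filter; ¬Any⇒All¬)
open import Data.List.Relation.Unary.Any using (here; there; any?)
open import Data.Product using (Σ; _×_; _,_; proj₁; proj₂; ∃; ∃₂; map₁; map₂)
open import Data.Sum using (_⊎_; inj₁; inj₂)
open import Data.Empty using (⊥-elim)
open import Data.Unit using (⊤; tt)
open import Function using (_∘_; id; case_of_)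
open import Relation.Nullary using (¬_; Dec; yes; no; does; contradiction)
open import Relation.Nullary.Decidable using (map′; _×-dec_)
open import Relation.Binary.PropositionalEquality using
  (_≡_; _≢_; refl; sym; trans; cong; cong₂; subst)

-- Signed coordinate substitutions

data Trit : Set where
  0ᵗ +ᵗ -ᵗ : Trit

neg : Trit → Trit
neg 0ᵗ = 0ᵗ
neg +ᵗ = -ᵗ
neg -ᵗ = +ᵗ

signed : Bool → Trit → Trit
signed true  = id
signed false = neg

signed-neg : ∀ s t → signed s (neg t) ≡ neg (signed s t)
signed-neg true  t = refl
signed-neg false t = refl

-- A signed substitution: coordinate i of M · x is 0, x_j or -x_j, so the images of the basis vectors
-- have disjoint supports.
Frame : ℕ → ℕ → Set
Frame k n = Vec (Maybe (Fin k × Bool)) n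

entry : ∀ {k} → Vec Trit k → Maybe (Fin k × Bool) → Trit
entry x nothing        = 0ᵗ
entry x (just (j , s)) = signed s (lookup x j)

infixr 7 _·_
_·_ : ∀ {k n} → Frame k n → Vec Trit k → Vec Trit n
M · x = map (entry x) M

-- Every variable occurs, so no nonzero vector is sent to 0; for `k = 2`, the two vectors that span
-- a line do not vanish.
Onto : ∀ {k n} → Frame k n → Set
Onto {k} {n} M = ∀ (j : Fin k) → ∃ λ (i : Fin n) → ∃ λ s → lookup M i ≡ just (j , s)

-- Good colourings and their symmetries

Colouring : ℕ → Set
Colouring n = Vec Trit n → Bool

Literal : ℕ → Set
Literal n = Vec Trit n × Bool

-- A conjunction of literals, to be refuted.
Clause : ℕ → Set
Clause n = List (Literal n)

Holds : ∀ {n} → Colouring n → Literal n → Set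
Holds χ (v , b) = χ v ≡ b

-- The nonzero vectors of {0, ±1}² up to sign; a frame turns them into a line p, q, p + q, p - q.
directions : List (Vec Trit 2)
directions =
  (+ᵗ ∷ 0ᵗ ∷ []) ∷ (0ᵗ ∷ +ᵗ ∷ []) ∷ (+ᵗ ∷ +ᵗ ∷ []) ∷ (+ᵗ ∷ -ᵗ ∷ []) ∷ []

square : Bool → Clause 2
square b = List.map (_, b) directions

record Good {n} (χ : Colouring n) : Set where
  field
    even : ∀ v → χ (map neg v) ≡ χ v
    line : ∀ (M : Frame 2 n) → Onto M → ∀ b → ¬ All (Holds (χ ∘ (M ·_))) (square b)

open Good

Refuted : ∀ {n} → Colouring n → Clause n → Set
Refuted χ C = ¬ All (Holds χ) C

Valid : ∀ {n} → Clause n → Set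
Valid {n} C = ∀ (χ : Colouring n) → Good χ → Refuted χ C

compose : ∀ {k m} → Frame k m → Maybe (Fin m × Bool) → Maybe (Fin k × Bool)
compose N nothing          = nothing
compose N (just (j , s)) with lookup N j
... | nothing       = nothing
-- With `true` as the sign +, this is the product of the two signs.
... | just (i , t) = just (i , (if s then t else not t))

entry-compose : ∀ {k m} (N : Frame k m) x e → entry x (compose N e) ≡ entry (N · x) e
entry-compose N x nothing = refl
entry-compose N x (just (j , s)) rewrite lookup-map j (entry x) N with lookup N j
... | nothing = lem s where
  lem : ∀ s → 0ᵗ ≡ signed s 0ᵗ
  lem true  = refl
  lem false = refl
... | just (i , t) = lem s t (lookup x i) where
  lem : ∀ s t u → signed (if s then t else not t) u ≡ signed s (signed t u)
  lem true  t     u = refl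
  lem false true  u = refl
  lem false false 0ᵗ = refl
  lem false false +ᵗ = refl
  lem false false -ᵗ = refl

compose-· : ∀ {k m n} (M : Frame m n) (N : Frame k m) x → map (compose N) M · x ≡ M · (N · x)
compose-· M N x = trans (sym (map-∘ (entry x) (compose N) M)) (map-cong (entry-compose N x) M)

compose-onto : ∀ {k m n} (M : Frame m n) (N : Frame k m) → Onto M → Onto N → Onto (map (compose N) M)
compose-onto M N ontoM ontoN j with ontoN j
... | i , s , eq with ontoM i
... | h , t , eq′ = h , (if t then s else not s) ,
  trans (lookup-map h (compose N) M) (trans (cong (compose N) eq′) lem)
  where
  lem : compose N (just (i , t)) ≡ just (j , (if t then s else not s))
  lem rewrite eq = refl

·-neg : ∀ {k n} (M : Frame k n) x → M · map neg x ≡ map neg (M · x)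
·-neg M x = trans (map-cong lem M) (map-∘ neg (entry x) M)
  where
  lem : ∀ e → entry (map neg x) e ≡ neg (entry x e)
  lem nothing = refl
  lem (just (j , s)) = trans (cong (signed s) (lookup-map j neg x)) (signed-neg s _)

-- A line of the pullback is carried by `M` to a line of `χ`. This is what transports a lemma from
-- `k` coordinates to `n`.
pullback : ∀ {k n} {χ : Colouring n} (M : Frame k n) → Onto M → Good χ → Good (χ ∘ (M ·_))
even (pullback {χ = χ} M onto good) v = trans (cong χ (·-neg M v)) (even good _)
line (pullback {χ = χ} M onto good) N ontoN b all =
  line good (map (compose N) M) (compose-onto M N onto ontoN) b
    (All.map (λ {l} h → trans (cong χ (compose-· M N (proj₁ l))) h) all)

complement : ∀ {n} {χ : Colouring n} → Good χ → Good (not ∘ χ)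
even (complement good) v = cong not (even good v)
line (complement good) M onto b all =
  line good M onto (not b)
    (map⁺ (All.map (λ h → Bool.not-injective (trans h (sym (Bool.not-involutive b)))) (map⁻ {f = _, b} all)))

-- The representative of v up to sign.
canon : ∀ {n} → Vec Trit n → Vec Trit n
canon []       = []
canon (0ᵗ ∷ v) = 0ᵗ ∷ canon v
canon (+ᵗ ∷ v) = +ᵗ ∷ v
canon (-ᵗ ∷ v) = +ᵗ ∷ map neg v

canon-± : ∀ {n} (v : Vec Trit n) → canon v ≡ v ⊎ canon v ≡ map neg v
canon-± []       = inj₁ refl
canon-± (+ᵗ ∷ v) = inj₁ refl
canon-± (-ᵗ ∷ v) = inj₂ refl
canon-± (0ᵗ ∷ v) with canon-± v
... | inj₁ eq = inj₁ (cong (0ᵗ ∷_) eq)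
... | inj₂ eq = inj₂ (cong (0ᵗ ∷_) eq)

even-canon : ∀ {n} {χ : Colouring n} → Good χ → ∀ v → χ (canon v) ≡ χ v
even-canon {χ = χ} good v with canon-± v
... | inj₁ eq = cong χ eq
... | inj₂ eq = trans (cong χ eq) (even good v)

onto? : ∀ {k n} (M : Frame k n) → Dec (Onto M)
onto? M = Fin.all? λ j → Fin.any? λ i → dec (lookup M i) j
  where
  dec : ∀ {k} (e : Maybe (Fin k × Bool)) j → Dec (∃ λ s → e ≡ just (j , s))
  dec nothing        j = no λ ()
  dec (just (i , s)) j with i Fin.≟ j
  ... | yes refl = yes (s , refl)
  ... | no  i≢j  = no λ { (_ , refl) → i≢j refl }

-- Vectors are normalised so that `v` and its negative share one entry of the search state. Frames
-- that are not onto are dropped, since pulling back along them need not preserve `Good`.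
instances : ∀ {k n} → List (Frame k n) → Clause k → List (Clause n)
instances Ms C = List.map (λ M → List.map (map₁ (canon ∘ (M ·_))) C) (filter onto? Ms)

instances-valid : ∀ {k n} (Ms : List (Frame k n)) {C} → Valid C → All Valid (instances Ms C)
instances-valid Ms {C} valid = map⁺ (All.map lem (all-filter onto? Ms))
  where
  lem : ∀ {M} → Onto M → Valid (List.map (map₁ (canon ∘ (M ·_))) C)
  lem {M} onto χ good all =
    valid (χ ∘ (M ·_)) (pullback M onto good)
      (All.map (λ h → trans (sym (even-canon good _)) h) (map⁻ all))

complemented : ∀ {n} → Clause n → Clause n
complemented = List.map (map₂ not)

complemented-valid : ∀ {n} {C : Clause n} → Valid C → Valid (complemented C)
complemented-valid valid χ good all =
  valid (not ∘ χ) (complement good) (All.map (λ h → trans (cong not h) (Bool.not-involutive _)) (map⁻ all))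

square-valid : ∀ b → Valid (square b)
square-valid b χ good (p ∷ q ∷ r ∷ s ∷ []) =
  line good (just (0F , true) ∷ just (1F , true) ∷ [])
    (λ { 0F → 0F , true , refl ; 1F → 1F , true , refl }) b (p ∷ q ∷ r ∷ s ∷ [])

-- Tries indexed by vectors

data Trie (A : Set) : ℕ → Set where
  ∅    : ∀ {n} → Trie A n
  leaf : A → Trie A 0
  node : ∀ {n} → Trie A n → Trie A n → Trie A n → Trie A (suc n)

module _ {A : Set} (default : A) where

  get : ∀ {n} → Trie A n → Vec Trit n → A
  get ∅            _        = default
  get (leaf a)     []       = a
  get (node l m r) (0ᵗ ∷ v) = get l v
  get (node l m r) (+ᵗ ∷ v) = get m v
  get (node l m r) (-ᵗ ∷ v) = get r v

  update : ∀ {n} → (A → A) → Trie A n → Vec Trit n → Trie A n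
  update f ∅            []       = leaf (f default)
  update f (leaf a)     []       = leaf (f a)
  update f ∅            (0ᵗ ∷ v) = node (update f ∅ v) ∅ ∅
  update f ∅            (+ᵗ ∷ v) = node ∅ (update f ∅ v) ∅
  update f ∅            (-ᵗ ∷ v) = node ∅ ∅ (update f ∅ v)
  update f (node l m r) (0ᵗ ∷ v) = node (update f l v) m r
  update f (node l m r) (+ᵗ ∷ v) = node l (update f m v) r
  update f (node l m r) (-ᵗ ∷ v) = node l m (update f r v)

  -- A one-sided specification: any entry that changes is the one at `v`. It is proved by descending
  -- the trie, without deciding equality of vectors.
  Updated : ∀ {n} → (A → A) → Trie A n → (v w : Vec Trit n) → Set
  Updated f t v w =
    get (update f t v) w ≡ get t w ⊎ v ≡ w × get (update f t v) w ≡ f (get t w)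

  updated-under : ∀ {n} f (t : Trie A n) c {v w} → Updated f t v w →
    get (update f t v) w ≡ get t w ⊎ c Vec.∷ v ≡ c ∷ w × get (update f t v) w ≡ f (get t w)
  updated-under f t c (inj₁ eq)          = inj₁ eq
  updated-under f t c (inj₂ (refl , eq)) = inj₂ (refl , eq)

  updated : ∀ {n} f (t : Trie A n) v w → Updated f t v w
  updated f ∅            []       []       = inj₂ (refl , refl)
  updated f (leaf a)     []       []       = inj₂ (refl , refl)
  updated f ∅            (0ᵗ ∷ v) (0ᵗ ∷ w) = updated-under f ∅ 0ᵗ (updated f ∅ v w)
  updated f ∅            (0ᵗ ∷ v) (+ᵗ ∷ w) = inj₁ refl
  updated f ∅            (0ᵗ ∷ v) (-ᵗ ∷ w) = inj₁ refl
  updated f ∅            (+ᵗ ∷ v) (0ᵗ ∷ w) = inj₁ refl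
  updated f ∅            (+ᵗ ∷ v) (+ᵗ ∷ w) = updated-under f ∅ +ᵗ (updated f ∅ v w)
  updated f ∅            (+ᵗ ∷ v) (-ᵗ ∷ w) = inj₁ refl
  updated f ∅            (-ᵗ ∷ v) (0ᵗ ∷ w) = inj₁ refl
  updated f ∅            (-ᵗ ∷ v) (+ᵗ ∷ w) = inj₁ refl
  updated f ∅            (-ᵗ ∷ v) (-ᵗ ∷ w) = updated-under f ∅ -ᵗ (updated f ∅ v w)
  updated f (node l m r) (0ᵗ ∷ v) (0ᵗ ∷ w) = updated-under f l 0ᵗ (updated f l v w)
  updated f (node l m r) (0ᵗ ∷ v) (+ᵗ ∷ w) = inj₁ refl
  updated f (node l m r) (0ᵗ ∷ v) (-ᵗ ∷ w) = inj₁ refl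
  updated f (node l m r) (+ᵗ ∷ v) (0ᵗ ∷ w) = inj₁ refl
  updated f (node l m r) (+ᵗ ∷ v) (+ᵗ ∷ w) = updated-under f m +ᵗ (updated f m v w)
  updated f (node l m r) (+ᵗ ∷ v) (-ᵗ ∷ w) = inj₁ refl
  updated f (node l m r) (-ᵗ ∷ v) (0ᵗ ∷ w) = inj₁ refl
  updated f (node l m r) (-ᵗ ∷ v) (+ᵗ ∷ w) = inj₁ refl
  updated f (node l m r) (-ᵗ ∷ v) (-ᵗ ∷ w) = updated-under f r -ᵗ (updated f r v w)

-- Partial assignments and watch tables

Assignment : ℕ → Set
Assignment = Trie (Maybe Bool)

value : ∀ {n} → Assignment n → Vec Trit n → Maybe Bool
value = get nothing

assign : ∀ {n} → Literal n → Assignment n → Assignment n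
assign (v , b) ρ = update nothing (λ _ → just b) ρ v

Agrees : ∀ {n} → Colouring n → Assignment n → Set
Agrees χ ρ = ∀ v {b} → value ρ v ≡ just b → χ v ≡ b

assign-agrees : ∀ {n} {χ : Colouring n} {ρ} l → Agrees χ ρ → Holds χ l → Agrees χ (assign l ρ)
assign-agrees {ρ = ρ} (v , b) agrees holds w eq with updated nothing (λ _ → just b) ρ v w
... | inj₁ same          = agrees w (trans (sym same) eq)
... | inj₂ (refl , new) = trans holds (just-injective (trans (sym new) eq))

-- Under a vector, a table lists the clauses to revisit once this vector is red and once it is blue, each
-- without the literal that has then become true.
Watch : ℕ → Set
Watch n = List (Clause n) × List (Clause n)

Table : ℕ → Set
Table n = Trie (Watch n) n

watched : ∀ {n} → Watch n → Bool → List (Clause n)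
watched (cs , _) true  = cs
watched (_ , cs) false = cs

row : ∀ {n} → Table n → Literal n → List (Clause n)
row t (v , b) = watched (get ([] , []) t v) b

insert : ∀ {n} → Literal n × Clause n → Table n → Table n
insert ((v , true)  , C) t = update ([] , []) (map₁ (C ∷_)) t v
insert ((v , false) , C) t = update ([] , []) (map₂ (C ∷_)) t v

picks : ∀ {A : Set} → List A → List (A × List A)
picks []       = []
picks (x ∷ xs) = (x , xs) ∷ List.map (map₂ (x ∷_)) (picks xs)

table : ∀ {n} → List (Clause n) → Table n
table = foldr (λ C t → foldr insert t (picks C)) ∅

Sound : ∀ {n} → Colouring n → Table n → Set
Sound χ t = ∀ l → Holds χ l → All (Refuted χ) (row t l)

insert-sound : ∀ {n} {χ : Colouring n} {l C t} →
               (Holds χ l → Refuted χ C) → Sound χ t → Sound χ (insert (l , C) t)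
insert-sound {l = v , true} {C} {t} ref sound (w , b) h
  with updated ([] , []) (map₁ (C ∷_)) t v w | b | h | sound (w , b) h
... | inj₁ eq          | _     | _ | s rewrite eq = s
... | inj₂ (refl , eq) | true  | h | s rewrite eq = ref h ∷ s
... | inj₂ (refl , eq) | false | h | s rewrite eq = s
insert-sound {l = v , false} {C} {t} ref sound (w , b) h
  with updated ([] , []) (map₂ (C ∷_)) t v w | b | h | sound (w , b) h
... | inj₁ eq          | _     | _ | s rewrite eq = s
... | inj₂ (refl , eq) | true  | h | s rewrite eq = s
... | inj₂ (refl , eq) | false | h | s rewrite eq = ref h ∷ s

picks-rest : ∀ {n} {χ : Colouring n} C →
             All (λ (l , D) → Holds χ l → All (Holds χ) D → All (Holds χ) C) (picks C)
picks-rest []      = []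
picks-rest (l ∷ C) = _∷_ ∷ map⁺ (All.map (λ { rest h (h₀ ∷ hs) → h₀ ∷ rest h hs }) (picks-rest C))

table-sound : ∀ {n} {χ : Colouring n} {Cs} → All (Refuted χ) Cs → Sound χ (table Cs)
table-sound [] (v , true)  _ = []
table-sound [] (v , false) _ = []
table-sound {χ = χ} {C ∷ Cs} (ref ∷ refs) = add (picks-rest C)
  where
  add : ∀ {ps} → All (λ (l , D) → Holds χ l → All (Holds χ) D → All (Holds χ) C) ps →
        Sound χ (foldr insert (table Cs) ps)
  add []             = table-sound refs
  add (rest ∷ rests) = insert-sound (λ h hs → ref (rest h hs)) (add rests)

-- Unit propagation

-- Clauses being conjunctions to refute, `conflict` means that all literals are true, `unit l` that
-- all but the unassigned `l` are, so that `l` must fail; `pending` allows no conclusion.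
data Status (n : ℕ) : Set where
  pending conflict : Status n
  unit             : Literal n → Status n

scan₁ : ∀ {n} → Assignment n → Literal n → Clause n → Status n
step₁ : ∀ {n} → Maybe Bool → Bool → Assignment n → Literal n → Clause n → Status n
scan₁ ρ l []            = unit l
scan₁ ρ l ((v , b) ∷ C) = step₁ (value ρ v) b ρ l C
step₁ nothing      _     ρ l C = pending
step₁ (just true)  true  ρ l C = scan₁ ρ l C
step₁ (just false) false ρ l C = scan₁ ρ l C
step₁ (just true)  false ρ l C = pending
step₁ (just false) true  ρ l C = pending

scan : ∀ {n} → Assignment n → Clause n → Status n
step : ∀ {n} → Maybe Bool → Literal n → Assignment n → Clause n → Status n
scan ρ []      = conflict
scan ρ (l ∷ C) = step (value ρ (proj₁ l)) l ρ C
step nothing      l           ρ C = scan₁ ρ l C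
step (just true)  (_ , true)  ρ C = scan ρ C
step (just false) (_ , false) ρ C = scan ρ C
step (just true)  (_ , false) ρ C = pending
step (just false) (_ , true)  ρ C = pending

Implied : ∀ {n} → Colouring n → Clause n → Status n → Set
Implied χ C pending    = ⊤
Implied χ C conflict = All (Holds χ) C
Implied χ C (unit l) = Holds χ l → All (Holds χ) C

implied-∷ : ∀ {n} {χ : Colouring n} {l C} s → Holds χ l → Implied χ C s → Implied χ (l ∷ C) s
implied-∷ pending    h _  = tt
implied-∷ conflict h hs = h ∷ hs
implied-∷ (unit l) h hs = λ h′ → h ∷ hs h′

implied₁-∷ : ∀ {n} {χ : Colouring n} {l k C} s →
             Holds χ k → Implied χ (l ∷ C) s → Implied χ (l ∷ k ∷ C) s
implied₁-∷ pending    h _         = tt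
implied₁-∷ conflict h (g ∷ hs) = g ∷ h ∷ hs
implied₁-∷ (unit m) h hs h′ with hs h′
... | g ∷ gs = g ∷ h ∷ gs

scan₁-implied : ∀ {n} {χ : Colouring n} {ρ} l C → Agrees χ ρ → Implied χ (l ∷ C) (scan₁ ρ l C)
scan₁-implied l [] agrees h = h ∷ []
scan₁-implied {ρ = ρ} l ((v , b) ∷ C) agrees with value ρ v in eq | b
... | nothing    | _     = tt
... | just true  | true  = implied₁-∷ (scan₁ ρ l C) (agrees v eq) (scan₁-implied {ρ = ρ} l C agrees)
... | just false | false = implied₁-∷ (scan₁ ρ l C) (agrees v eq) (scan₁-implied {ρ = ρ} l C agrees)
... | just true  | false = tt
... | just false | true  = tt

scan-implied : ∀ {n} {χ : Colouring n} {ρ} C → Agrees χ ρ → Implied χ C (scan ρ C)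
scan-implied [] agrees = []
scan-implied {ρ = ρ} ((v , b) ∷ C) agrees with value ρ v in eq | b
... | nothing    | b     = scan₁-implied {ρ = ρ} (v , b) C agrees
... | just true  | true  = implied-∷ (scan ρ C) (agrees v eq) (scan-implied {ρ = ρ} C agrees)
... | just false | false = implied-∷ (scan ρ C) (agrees v eq) (scan-implied {ρ = ρ} C agrees)
... | just true  | false = tt
... | just false | true  = tt

consequences : ∀ {n} → Assignment n → List (Clause n) → List (Literal n) → Maybe (List (Literal n))
consequences ρ []       q = just q
consequences ρ (C ∷ Cs) q with scan ρ C
... | pending        = consequences ρ Cs q
... | conflict     = nothing
... | unit (v , b) = consequences ρ Cs ((v , not b) ∷ q)

-- `Any` on `Maybe` also excludes `nothing`: no conflict can arise while some colouring agrees with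
-- the assignment and refutes every clause.
consequences-sound : ∀ {n} {χ : Colouring n} {ρ} Cs {q} → Agrees χ ρ → All (Refuted χ) Cs → All (Holds χ) q →
                     Any (All (Holds χ)) (consequences ρ Cs q)
consequences-sound [] agrees _ holds = just holds
consequences-sound {ρ = ρ} (C ∷ Cs) agrees (ref ∷ refs) holds with scan ρ C | scan-implied {ρ = ρ} C agrees
... | pending        | _ = consequences-sound {ρ = ρ} Cs agrees refs holds
... | conflict     | h = ⊥-elim (ref h)
... | unit (v , b) | h = consequences-sound {ρ = ρ} Cs agrees refs (Bool.¬-not (ref ∘ h) ∷ holds)

-- Stopping when the fuel is used up is sound: it merely leaves consequences undrawn.
propagate : ∀ {n} → ℕ → Table n → List (Literal n) → Assignment n → Maybe (Assignment n)
propagate zero    t _ ρ  = just ρ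
propagate (suc f) t [] ρ = just ρ
propagate (suc f) t ((v , b) ∷ q) ρ with value ρ v | b
... | just true  | true  = propagate f t q ρ
... | just false | false = propagate f t q ρ
... | just true  | false = nothing
... | just false | true  = nothing
... | nothing    | b     = let ρ′ = assign (v , b) ρ in
  consequences ρ′ (row t (v , b)) q >>= λ q′ → propagate f t q′ ρ′

propagate-sound : ∀ {n} {χ : Colouring n} f {t q ρ} → Sound χ t → All (Holds χ) q → Agrees χ ρ →
                  Any (Agrees χ) (propagate f t q ρ)
propagate-sound zero sound holds agrees = just agrees
propagate-sound (suc f) {q = []} sound holds agrees = just agrees
propagate-sound (suc f) {t} {(v , b) ∷ q} {ρ} sound (h ∷ holds) agrees with value ρ v in eq | b
... | just true  | true  = propagate-sound f sound holds agrees
... | just false | false = propagate-sound f sound holds agrees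
... | just true  | false = case trans (sym (agrees v eq)) h of λ ()
... | just false | true  = case trans (sym (agrees v eq)) h of λ ()
... | nothing    | b
  with agrees′ ← assign-agrees {ρ = ρ} (v , b) agrees h
  with consequences (assign (v , b) ρ) (row t (v , b)) q
     | consequences-sound {ρ = assign (v , b) ρ} (row t (v , b)) agrees′ (sound (v , b) h) holds
... | just q′ | just holds′ = propagate-sound f sound holds′ agrees′

-- Branching search guided by a certificate

fuel : ℕ
fuel = 100000

-- The certificate lists, in preorder, the vectors to branch on; a branch that propagation refutes
-- uses up none of it.
search : ∀ {n} → ℕ → Table n → List (Vec Trit n) → Assignment n → Maybe (List (Vec Trit n))
branch : ∀ {n} → ℕ → Table n → List (Vec Trit n) → Literal n → Assignment n → Maybe (List (Vec Trit n))
-- Lack of fuel and an exhausted certificate both count as failure, so neither can yield a false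
-- refutation.
search zero    t _        ρ = nothing
search (suc f) t []       ρ = nothing
search (suc f) t (v ∷ vs) ρ = branch f t vs (v , true) ρ >>= λ vs′ → branch f t vs′ (v , false) ρ
branch f t vs l ρ with propagate fuel t (l ∷ []) ρ
... | nothing = just vs
... | just ρ′ = search f t vs ρ′

>>=-nothing : ∀ {A B : Set} (m : Maybe A) {k : A → Maybe B} →
              (∀ x → k x ≡ nothing) → (m >>= k) ≡ nothing
>>=-nothing nothing  _ = refl
>>=-nothing (just x) h = h x

-- Read contrapositively, a successful search leaves no agreeing colouring. The proof follows the
-- colour that `χ` gives to `v`; if it is `false`, the first branch may succeed, so every remainder
-- of the certificate is covered.
search-sound : ∀ {n} {χ : Colouring n} f {t vs ρ} → Sound χ t → Agrees χ ρ → search f t vs ρ ≡ nothing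
branch-sound : ∀ {n} {χ : Colouring n} f {t vs l ρ} →
               Sound χ t → Holds χ l → Agrees χ ρ → branch f t vs l ρ ≡ nothing
search-sound zero sound agrees = refl
search-sound (suc f) {vs = []} sound agrees = refl
search-sound {χ = χ} (suc f) {t} {v ∷ vs} {ρ} sound agrees with χ v in eq
... | true  =
  cong (_>>= λ vs′ → branch f t vs′ (v , false) ρ) (branch-sound f {vs = vs} {v , true} {ρ} sound eq agrees)
... | false =
  >>=-nothing (branch f t vs (v , true) ρ) λ vs′ → branch-sound f {vs = vs′} {v , false} {ρ} sound eq agrees
branch-sound f {t} {vs} {l} {ρ} sound h agrees
  with propagate fuel t (l ∷ []) ρ | propagate-sound fuel {t} {l ∷ []} {ρ} sound (h ∷ []) agrees
... | just ρ′ | just agrees′ = search-sound f sound agrees′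

exhausts : ∀ {n} → Table n → List (Vec Trit n) → Maybe (Assignment n) → Bool
exhausts t vs nothing  = true
exhausts t vs (just ρ) = is-just (search fuel t vs ρ)

exhausts-sound : ∀ {n} {χ : Colouring n} {t m} vs →
                 Sound χ t → Any (Agrees χ) m → exhausts t vs m ≡ false
exhausts-sound vs sound (just {ρ} agrees) = cong is-just (search-sound fuel {vs = vs} {ρ} sound agrees)

-- A vector is written with the digits 0, 1, 2 for 0, +, - in base 3, first coordinate least significant,
-- and a block consists of such numbers with three decimal digits each.
decode : ∀ n → ℕ → Vec Trit n
decode zero    c = []
decode (suc n) c = trit (c % 3) ∷ decode n (c / 3)
  where
  trit : ℕ → Trit
  trit 0 = 0ᵗ
  trit 1 = +ᵗ
  trit _ = -ᵗ

decodeBlock : ∀ n → ℕ → ℕ → List (Vec Trit n) → List (Vec Trit n)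
decodeBlock n zero    c vs = vs
decodeBlock n (suc f) 0 vs = vs
decodeBlock n (suc f) c vs = decodeBlock n f (c / 1000) (decode n (c % 1000) ∷ vs)

decodeBlocks : ∀ n → List ℕ → List (Vec Trit n)
decodeBlocks n = foldr (decodeBlock n 1000) []

-- Collections of lemmas, and refutation by computation

Lemmas : ℕ → Set
Lemmas n = ∃ λ (Cs : List (Clause n)) → All Valid Cs

infixl 4 _and_on_
_and_on_ : ∀ {k n} {C : Clause k} → Lemmas n → Valid C → List (Frame k n) → Lemmas n
_and_on_ {C = C} (Cs , valids) valid Ms = instances Ms C ++ Cs , ++⁺ (instances-valid Ms valid) valids

refutes : ∀ {n} → Table n → List (Vec Trit n) → Clause n → Bool
refutes t vs C = exhausts t vs (propagate fuel t C ∅)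

-- In each use the last hypothesis equates closed Booleans, so `refl` makes the type checker run the
-- search.
refute : ∀ {n} {C : Clause n} (L : Lemmas n) certificate →
         refutes (table (proj₁ L)) (decodeBlocks n certificate) C ≡ true → Valid C
refute {n} {C} (Cs , valids) certificate eq χ good holds =
  case trans (sym eq) (exhausts-sound (decodeBlocks n certificate) sound
    (propagate-sound fuel {ρ = ∅} sound holds (λ _ ()))) of λ ()
  where
  sound : Sound χ (table Cs)
  sound = table-sound (All.map (λ v → v χ good) valids)

-- One representative of every line, up to the signs and the order of p and q: frames₂ is unrestricted,
-- in frames₁ the support of p has begun already and that of q has not, in frames₀ neither has.
frames₀ frames₁ frames₂ : ∀ n → List (Frame 2 n)
frames₂ zero    = [] ∷ []
frames₂ (suc n) = List.concatMap (λ e → List.map (e ∷_) (frames₂ n))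
  (nothing ∷ just (0F , true) ∷ just (0F , false) ∷ just (1F , true) ∷ just (1F , false) ∷ [])
frames₁ zero    = []
frames₁ (suc n) = List.concatMap (λ e → List.map (e ∷_) (frames₁ n))
  (nothing ∷ just (0F , true) ∷ just (0F , false) ∷ []) ++ List.map (just (1F , true) ∷_) (frames₂ n)
frames₀ zero    = []
frames₀ (suc n) = List.map (nothing ∷_) (frames₀ n) ++ List.map (just (0F , true) ∷_) (frames₁ n)

lines : ∀ n → Lemmas n
lines n = ([] , []) and square-valid true on frames₀ n and square-valid false on frames₀ n

-- Vocabulary for clauses and their symmetries

e : ∀ {n} → ℕ → Vec Trit n
e {zero}  _       = []
e {suc n} zero    = +ᵗ ∷ replicate n 0ᵗ
e {suc n} (suc i) = 0ᵗ ∷ e i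

-- Meant for summands of which one is 0.
plus : Trit → Trit → Trit
plus 0ᵗ t = t
plus s _ = s

infixl 6 _⊕_ _⊖_
_⊕_ _⊖_ : ∀ {n} → Vec Trit n → Vec Trit n → Vec Trit n
_⊕_ = zipWith plus
u ⊖ v = u ⊕ map neg v

reds blues : ∀ {n} → List (Vec Trit n) → Clause n
reds  = List.map (_, true)
blues = List.map (_, false)

heads : ∀ {A : Set} → List (List A) → List (A × List (List A))
heads []              = []
heads ([] ∷ qs)       = heads qs
heads ((x ∷ q) ∷ qs) = (x , q ∷ qs) ∷ List.map (map₂ ((x ∷ q) ∷_)) (heads qs)

-- A queue keeps its order in every interleaving, which spares the permutations of its own entries;
-- singleton queues give all permutations.
shuffles : ∀ {A : Set} n → List (List A) → List (Vec A n)
shuffles zero    qs = [] ∷ []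
shuffles (suc n) qs = List.concatMap (λ (x , qs′) → List.map (x ∷_) (shuffles n qs′)) (heads qs)

pos : ∀ {k} → Fin k → Maybe (Fin k × Bool)
pos j = just (j , true)

ps : ∀ {k} → List (Fin k) → List (Maybe (Fin k × Bool))
ps = List.map pos

signings : ∀ {k n} → Frame k n → List (Frame k n)
signings []                 = [] ∷ []
signings (nothing ∷ M)      = List.map (nothing ∷_) (signings M)
signings (just (j , s) ∷ M) =
  List.map (just (j , s) ∷_) (signings M) ++ List.map (just (j , not s) ∷_) (signings M)

-- The sign of the first entry can be kept since colourings are even.
signingsOfTail : ∀ {k n} → Frame k (suc n) → List (Frame k (suc n))
signingsOfTail (m ∷ M) = List.map (m ∷_) (signings M)

permutations : ∀ {k} (js : List (Fin k)) → List (Frame k (List.length js))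
permutations js = shuffles (List.length js) (List.map (λ j → pos j ∷ []) js)

-- Five disjoint vectors do not split 3 : 2

splitSymmetries : List (Frame 5 5)
splitSymmetries = List.concatMap signingsOfTail
  (List.cartesianProductWith Vec._++_ (permutations (0F ∷ 1F ∷ 2F ∷ [])) (permutations (3F ∷ 4F ∷ [])))

-- Each of these is refuted with the help of the images of its extensions under the symmetries of split,
-- which replaces the usual "without loss of generality".
split split₂ split₃ split₃a split₃b split₂a split₁a : Clause 5
split = reds (e 0 ∷ e 1 ∷ e 2 ∷ []) ++ blues (e 3 ∷ e 4 ∷ [])
split₂ = split ++ reds (e 0 ⊕ e 1 ∷ e 3 ⊕ e 4 ∷ [])
split₃ = split₂ ++ reds (e 0 ⊕ e 2 ∷ [])
split₃a = split₃ ++ reds (e 0 ⊕ e 1 ⊕ e 2 ⊕ e 3 ⊖ e 4 ∷ [])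
split₃b = split₃a ++ reds (e 0 ⊕ e 1 ⊕ e 3 ∷ [])
split₂a = split₂ ++ reds (e 2 ⊕ e 3 ∷ [])
split₁a = split ++ reds (e 0 ⊕ e 1 ⊕ e 3 ∷ [])

split₃b-valid : Valid split₃b
split₃b-valid = refute (lines 5)
    ( 130198238189225112052121160088199214214214232160049199192241229030121205049061133030124
    ∷ 201199160229232199192154124148214118133052163048205232061241133028229192241012079067012
    ∷ 109163232160241189226055165229030211030034214201021160030157124039021163214208184148124
    ∷ 151082124148211157124124049241039183157238133124226030133192192124121021181232148238148
    ∷ 163090124082241157205036118171030121151030100228061151070121154121192160121214049214124
    ∷ 151109124021151040133214090232151118121133082151057079238061172082030139214036073151232
    ∷ 39028133040012232148133174238121232093012094082151211100133165220076040034124084199121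
    ∷ 90214148151067214172121094199214192214183232030021121109205084057238214090117210171121
    ∷ 151061148151102214021121109232030214205124090046205151144133232097205144121238118021067
    ∷ 52012214217232148151232232151214205034190160189229028151160214205151238034124192097034
    ∷ 133151160238157117028174124211052148193085232121229036211109183013028117157174088109034
    ∷ 49148211211063075021237067028175094229118157021217124075057133055238121183036021148061
    ∷ 70121067012214012210148144012124157160157214094124144021157148133021211189124211070091
    ∷ 145021232121214148211109229120112232012157205063082112205 ∷ []) refl

split₃a-valid : Valid split₃a
split₃a-valid = refute (lines 5 and split₃b-valid on splitSymmetries)
    ( 199193021160189091190151145210121241028111157157124139156130133229238121189091160012189
    ∷ 91214229121232130130 ∷ []) refl

split₃-valid : Valid split₃
split₃-valid = refute (lines 5 and split₃a-valid on splitSymmetries)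
    ( 189021012103106172193057030091120057030226036055093097165228030057193055028093211091238
    ∷ 178166199063036166174151201063030190217085151130157157058151157238238109166205211238238
    ∷ 31205130211211021229070049184151237228084036124178175039228093012012106151052193163205
    ∷ 36124157133205171172208037084085232156142130157165151133082076178157232102211124184175
    ∷ 67039228093012012106157055238055157232055238130211165166196058139064145090063093226012
    ∷ 147066091057172133211151214208214208160052049070121097211237120171057238103094066120174
    ∷ 12012187211079145082157057238205241157084085142184091084232157058103172031102121151097
    ∷ 238075133097075043121103205130102151238097040094174120066012012079151082124082151130028
    ∷ 124232151090091154039066103178097106103184037031121193199165030174112012201039166036085
    ∷ 241151211160142160142214079052178130211 ∷ []) refl

split₂a-valid : Valid split₂a
split₂a-valid = refute (lines 5 and split₃-valid on splitSymmetries)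
    ( 39070037028121117214157189124211163093238205037241232148205124148189118091082214073079
    ∷ 57238117214202189124148084181121189124133211160241211189235181163151063052049067130229
    ∷ 40037211160160189133084174133205075148160232198211102160198211214120165075109238165241
    ∷ 157163075160148151048241037183028214133219238214124102030174133181183157202084037160082
    ∷ 241 ∷ []) refl

split₂-valid : Valid split₂
split₂-valid = refute (lines 5 and split₃-valid on splitSymmetries
    and split₂a-valid on splitSymmetries)
    (198144199148202201241202148147232 ∷ []) refl

-- As `e 3` and `e 4` are blue, their sum or their difference is red, so the images of `split₂` turn
-- every sum and difference of two of `e 0`, `e 1`, `e 2` blue.
split₁a-valid : Valid split₁a
split₁a-valid = refute (lines 5 and split₂-valid on splitSymmetries) (19012007010021004061079067076049076067 ∷ []) refl

split-valid : Valid split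
split-valid = refute (lines 5 and split₂-valid on splitSymmetries and split₁a-valid on splitSymmetries) [] refl

-- One blue vector among four red ones

isolatedSymmetries : List (Frame 5 5)
isolatedSymmetries = List.concatMap signingsOfTail
  (List.map (λ M → pos 0F ∷ (M Vec.++ (pos 4F ∷ []))) (permutations (1F ∷ 2F ∷ 3F ∷ [])))

isolated isolated₁ isolated₂ isolated₂a : Clause 5
isolated = reds (e 0 ∷ e 1 ∷ e 2 ∷ e 3 ∷ []) ++ blues (e 4 ∷ e 0 ⊕ e 4 ∷ e 0 ⊖ e 4 ∷ [])
isolated₁ = isolated ++ reds (e 1 ⊕ e 2 ∷ [])
isolated₂ = isolated₁ ++ reds (e 1 ⊕ e 3 ∷ [])
isolated₂a = isolated₂ ++ reds (e 0 ⊕ e 1 ⊕ e 2 ⊕ e 4 ∷ [])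

isolated₂a-valid : Valid isolated₂a
isolated₂a-valid = refute (lines 5)
    ( 148160157055214220238211124190241205232103211202238238229043118190235130208019171019202
    ∷ 102103211004151211189235151004120036133007127238120151064130205151220010241238208202151
    ∷ 226063229226090214124036108241232169183004036084165039205214211084241010238124036208232
    ∷ 151202109130238232084010063142084028084063055183214076202010118229241226202229010202130
    ∷ 124106178232229007084196007238223238211214055211226238214226004202214202211151063133130
    ∷ 229085232025241229063004232225157031139238219229090036205124007124133220007103171229174
    ∷ 10232151157229151165229232063229238211151097205010232063010063145157232130063205004220
    ∷ 144133241055238139151036178211010238139103055103130063004151064036010004004157063097133
    ∷ 196010232205130160189039211084136055108226160007055121112211202232039028229229241093160
    ∷ 202130019183238229183205138232010039121112241007007028202048036090241232121007036210130
    ∷ 232205055129130112157010189241136055108076004238211160160241039055090121241160157238007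
    ∷ 63232010237229157184100205237229004238100019184052010165004232223160130241232121171211
    ∷ 238205241025205202010037208232199004199229036238004192184130133036208004238202241189178
    ∷ 151121232214205238028160124019178121229238138102004211084093160238211019039108004121124
    ∷ 124172039181211040055202004124028196214199229193238202211136166198039189238232145028102
    ∷ 241090238019208214076232019241214178129205238202010202238013004063211202019028211214019
    ∷ 66121211102004202010202238205198189229202117232211205232238229004093124138028202121238
    ∷ 171160235064202156019124084241120121004184124160121187205232211028007019202232211160028
    ∷ 241 ∷ []) refl

-- Again without branching: with q = e₁ + e₂ red, `isolated₂a` makes all e₀ ± q ± e₄ blue; since e₄
-- is blue, e₀ + q and e₀ - q are red, and they complete a red line with e₀ and q.
isolated₂-valid : Valid isolated₂
isolated₂-valid = refute (lines 5 and isolated₂a-valid on isolatedSymmetries) [] refl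

isolated₁-valid : Valid isolated₁
isolated₁-valid = refute (lines 5 and isolated₂-valid on isolatedSymmetries)
    ( 7202211112139130175091090010100145238130220139147214199196094019055217181229169160055
    ∷ 142010124127157214019055148130097028121130157151189211133172175115226238192187151171156
    ∷ 144127133118115046205136100225157133198148238028241117144147157156138214211094157232220
    ∷ 28229139226028157145133049193220139223214205115142160019112223232130187100171232148190
    ∷ 157142223202028193121237208193106076019217172241166115112151148118151202238055189232121
    ∷ 130124103115028133124151157172189205112138108138055229192130157112028229223055238196127
    ∷ 112037211136091117151144229226235229090010148151109154079205226199028028142157121028090
    ∷ 28145235226154079121232232235202219160220115028223208241202198028 ∷ []) refl

-- The images of `isolated₁` make every sum and difference of two of `e 1`, `e 2`, `e 3` blue.
isolated-valid : Valid isolated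
isolated-valid = refute (lines 5 and isolated₁-valid on isolatedSymmetries)
    ( 7205202229226214241232196238166232124241118208226225144178211211193229076211175220019
    ∷ 55148121160151085109145130103220229232190238175121097184106187055130133091157112202196
    ∷ 139223127079142160241148151196157127151160223196232211202157196115157139238097130100148
    ∷ 214241232196229172238196229229232117120165156156147228129 ∷ []) refl

-- The blue vector becomes a sum or difference of two unit vectors, the red ones become the other four.
isolatedFrames : List (Frame 5 6)
isolatedFrames = List.concatMap
  (λ s → shuffles 6 ((pos 4F ∷ just (4F , s) ∷ []) ∷ ps (0F ∷ []) ∷ ps (1F ∷ 2F ∷ 3F ∷ []) ∷ []))
  (true ∷ false ∷ [])

-- Stars of red vectors around a unit vector

rays : List (Fin 6)
rays = 1F ∷ 2F ∷ 3F ∷ 4F ∷ 5F ∷ []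

star : ℕ → Clause 6
star k = reds (List.map (λ i → e (toℕ i)) (0F ∷ rays)) ++
  reds (List.map (λ i → e 0 ⊕ e (toℕ i)) (List.take k rays))

star₅a : Clause 6
star₅a = star 5 ++ reds (e 1 ⊕ e 2 ⊕ e 3 ⊖ e 5 ∷ [])

star₅aSymmetries recentrings : List (Frame 6 6)
star₅aSymmetries = List.concatMap signingsOfTail
  (List.map (pos 0F ∷_) (shuffles 5 (ps (1F ∷ []) ∷ ps (5F ∷ []) ∷ ps (2F ∷ 3F ∷ 4F ∷ []) ∷ [])))
recentrings = List.concatMap signingsOfTail (shuffles 6 (ps (0F ∷ []) ∷ ps rays ∷ []))

-- The centre stays, and `k` rays are chosen with all their signs; the other rays enter `star k`
-- only as unit vectors and keep the sign +.
starFrames : ℕ → List (Frame 6 6)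
starFrames k = List.concatMap
  (λ M → List.map (pos 0F ∷_) (shuffles 5 (Vec.toList M ∷ ps (List.drop k rays) ∷ [])))
  (signings (Vec.fromList (ps (List.take k rays))))

isolatedLemmas : Lemmas 6
isolatedLemmas = lines 6 and isolated-valid on isolatedFrames

star₅a-valid : Valid star₅a
star₅a-valid = refute isolatedLemmas
    ( 30031090091495505586649616403475039565273454727454273373727414649324718445475454160039
    ∷ 484211202607373445688607192688445211403475718697696406565516715718718697354727454616484
    ∷ 364445130607697232565111253552489502322543025247543292322039295270310295513550322300073
    ∷ 300279292322565319246181252253424649454373522498631691189616727484484322649318513300264
    ∷ 300292012516543270543063318036291246556565550012516543292502505667649333036559676721235
    ∷ 306388478694073559541279076562544543643025538360279541703217675478694333657343649586616
    ∷ 39727475688607646516697535679117643454445607697192052643048111061324325036037070270271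
    ∷ 252507489535565535495322048025012607039252549292310562489513130084085109151229090637646
    ∷ 570594481610084108513594586646594252253270543489553565553513322403171183184214108039724
    ∷ 376700727388718697400715372189322489273270295498073079025039270522516316304541526565322
    ∷ 556279273541283547322535039066067025070246247252306513535565535495322252253246300513529
    ∷ 565529489322649063073079025039270516522316304268262424565526322562279273541283559322529
    ∷ 39025727724718403075394325703651246475400325703367358351246484403165169187057219223655
    ∷ 513655651484037079048697688400327727376075657675691718715394403675651376400364075333403
    ∷ 651403025073048021727718376364325655675270634394703217322171040718691403652675651700724
    ∷ 12364058325727688403039111252355454036724351541111327043727700394364655658373346376718
    ∷ 667181322189 ∷ []) refl

star₅-valid : Valid (star 5)
star₅-valid = refute (isolatedLemmas and star₅a-valid on star₅aSymmetries)
    ( 21025351703649541217090658646700667688472181376454616634610448061394073400493505169333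
    ∷ 117445712637628048013109036247037085090279117253111091364688724472310718727367718727610
    ∷ 616367273567724718181507183184337333387727061718484493073169171181235187472634448700646
    ∷ 102655178724 ∷ []) refl

-- By `star 5`, recentred with all signs, every i has some j for which eᵢ + eⱼ and eᵢ - eⱼ are both
-- blue; for i = 0 this leaves only j = 5.
star₄-valid : Valid (star 4)
star₄-valid = refute (isolatedLemmas and star₅-valid on recentrings)
    ( 189217171181235117073021559316360451013079565187169012424667337084237117073165703460640
    ∷ 85187241223124219057091235165343223160030289586073225036057703613223232169031133219076
    ∷ 442613370057712031202124214109012252253268063658316313036424247246084304271169412651598
    ∷ 505511063667084556652570490489255495090559514181667414361025252268265036187661073316553
    ∷ 511247264495084079310169412661108616373117484367607364373610484727367727718142607 ∷ []) refl

-- The images of `star 4` make e₀ ± eⱼ blue for j = 4, 5. Each later step likewise gains all rays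
-- outside its star, up to `star 0`, where e₀ ± eⱼ is blue for every j.
star₃-valid : Valid (star 3)
star₃-valid = refute (isolatedLemmas and star₄-valid on starFrames 4)
    (324568489490574570412250489490655325250331649 ∷ []) refl

star₂-valid : Valid (star 2)
star₂-valid = refute (isolatedLemmas and star₃-valid on starFrames 3)
    ( 12013495496259498489511264286319283292310319286526313553529565513538270262502255246247
    ∷ 268259313556030529057346589337670418340430324673567025511489490496265664661580498421418
    ∷ 337 ∷ []) refl

star₁-valid : Valid (star 1)
star₁-valid = refute (isolatedLemmas and star₂-valid on starFrames 2)
    ( 108190136622352469307036316063595613586090424252324568595622685523063532495270298379351
    ∷ 351352298388334495658252622 ∷ []) refl

star₀-valid : Valid (star 0)
star₀-valid = refute (isolatedLemmas and star₁-valid on starFrames 1)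
    ( 246250495259256538292513553036268265427337567340084063037324406409328589349252664090495
    ∷ 280514712604189523271451090442171181208109124160057205030513541547544553529252084088574
    ∷ 325421673012012102178187133121189567325328166580108190433594252496502255057111223058463
    ∷ 306532073052283559 ∷ []) refl

-- Excluding good colourings in dimension 6

-- All choices of 5 unit vectors, and of 4 unit vectors with the sum or difference of the other two; in the
-- latter case that vector is on the smaller side of the split.
splitFrames : List (Frame 5 6)
splitFrames = List.concatMap (shuffles 6)
  ( (ps (0F ∷ 1F ∷ 2F ∷ []) ∷ ps (3F ∷ 4F ∷ []) ∷ (nothing ∷ []) ∷ [])
  ∷ (ps (0F ∷ 1F ∷ 2F ∷ []) ∷ ps (3F ∷ 3F ∷ []) ∷ ps (4F ∷ []) ∷ [])
  ∷ (ps (0F ∷ 1F ∷ 2F ∷ []) ∷ (pos 3F ∷ just (3F , false) ∷ []) ∷ ps (4F ∷ []) ∷ [])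
  ∷ [])

identityFrame : Frame 6 6
identityFrame = Vec.fromList (ps (0F ∷ rays))

-- `split` leaves the unit vectors 6 : 0 or 5 : 1. In the second case take u, v among the five: the
-- other four are coloured 3 : 1, so `split` gives u ± v the colour of u and v, a monochromatic
-- line. The certificate branches on unit vectors only; `star 0` and its complement exclude 6 : 0.
noGoodColouring : Valid {6} []
noGoodColouring = refute
  (lines 6
    and split-valid on splitFrames and complemented-valid split-valid on splitFrames
    and star₀-valid on (identityFrame ∷ []) and complemented-valid star₀-valid on (identityFrame ∷ []))
  (1243003081009027009081081003081243009027009243081 ∷ []) refl

-- Exhaustive search over finite types

Searchable : Set → Set₁
Searchable A = ∀ {P : A → Set} → (∀ a → Dec (P a)) → Dec (∃ P)

search-Bool : Searchable Bool
search-Bool P? with P? true | P? false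
... | yes p | _     = yes (true , p)
... | no _  | yes p = yes (false , p)
... | no ¬p | no ¬q = no λ { (true , p) → ¬p p ; (false , q) → ¬q q }

search-Maybe : ∀ {A} → Searchable A → Searchable (Maybe A)
search-Maybe search P? with P? nothing | search (P? ∘ just)
... | yes p | _           = yes (nothing , p)
... | no _  | yes (a , p) = yes (just a , p)
... | no ¬p | no ¬q       = no λ { (nothing , p) → ¬p p ; (just a , q) → ¬q (a , q) }

search-× : ∀ {A B} → Searchable A → Searchable B → Searchable (A × B)
search-× searchA searchB P? =
  map′ (λ { (a , b , p) → (a , b) , p }) (λ { ((a , b) , p) → a , b , p })
    (searchA λ a → searchB λ b → P? (a , b))

search-Vec : ∀ {A} n → Searchable A → Searchable (Vec A n)
search-Vec zero    search P? = map′ (λ p → [] , p) (λ { ([] , p) → p }) (P? [])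
search-Vec (suc n) search P? =
  map′ (λ { (a , v , p) → (a ∷ v) , p }) (λ { ((a ∷ v) , p) → a , v , p })
    (search λ a → search-Vec n search λ v → P? (a ∷ v))

-- Two-dimensional subcubes

lookup-injective : ∀ {A : Set} {n} {x y : Vec A n} → (∀ i → lookup x i ≡ lookup y i) → x ≡ y
lookup-injective {x = x} {y} eq =
  trans (sym (tabulate∘lookup x)) (trans (tabulate-cong eq) (tabulate∘lookup y))

grAct-injective : ∀ σ {a b} → grAct σ a ≡ grAct σ b → a ≡ b
grAct-injective false eq = eq
grAct-injective true  eq = Bool.not-injective eq

MonochromaticSquare : ∀ {m} → (Vec Bool m → Vec Bool m → Fin 2) → Set
MonochromaticSquare {m} c =
  Σ (Fin m → CoordSpec Bool Bool 2) λ s →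
    IsParamMap grAct s ×
    ∃ λ (col : Fin 2) → ∀ x y → x ≢ y → c (embed grAct s x) (embed grAct s y) ≡ col

-- `parameter` witnesses injectivity: each parameter can be read off, up to sign, from some
-- coordinate.
record Subsquare {m} (F : Vec Bool 2 → Vec Bool m) : Set where
  field
    coordinate : ∀ i → ∃ λ (sp : CoordSpec Bool Bool 2) → ∀ x → lookup (F x) i ≡ evalCoord grAct sp x
    parameter  : ∀ j → ∃₂ λ i σ → ∀ x → lookup (F x) i ≡ grAct σ (lookup x j)

monochromatic : ∀ {m} {c : Vec Bool m → Vec Bool m → Fin 2} {F} → Subsquare F →
                ∀ col → (∀ x y → x ≢ y → c (F x) (F y) ≡ col) → MonochromaticSquare c
monochromatic {c = c} {F} square col mono =
  proj₁ ∘ coordinate , injective , col ,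
  λ x y x≢y → trans (cong₂ c (embed≡F x) (embed≡F y)) (mono x y x≢y)
  where
  open Subsquare square
  embed≡F : ∀ x → embed grAct (proj₁ ∘ coordinate) x ≡ F x
  embed≡F x = lookup-injective λ i → trans (lookup∘tabulate _ i) (sym (proj₂ (coordinate i) x))
  injective : IsParamMap grAct (proj₁ ∘ coordinate)
  injective x y eq = lookup-injective λ j → let i , σ , val = parameter j in
    grAct-injective σ (trans (sym (val x)) (trans (cong (λ u → lookup u i)
      (trans (sym (embed≡F x)) (trans eq (embed≡F y)))) (val y)))

-- A map on two elements is constant, the identity or the negation.
unary : ∀ {k} (g : Bool → Bool) (j : Fin k) → ∃ λ sp → ∀ x → g (lookup x j) ≡ evalCoord grAct sp x
unary g j with g true in t | g false in f
... | true  | true  = const true , λ x → constant (lookup x j)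
  where constant : ∀ b → g b ≡ true
        constant true = t
        constant false = f
... | false | false = const false , λ x → constant (lookup x j)
  where constant : ∀ b → g b ≡ false
        constant true = t
        constant false = f
... | true  | false = var j false , λ x → identity (lookup x j)
  where identity : ∀ b → g b ≡ b
        identity true = t
        identity false = f
... | false | true  = var j true , λ x → negation (lookup x j)
  where negation : ∀ b → g b ≡ not b
        negation true = t
        negation false = f

-- From four letters to pairs of signs

-- half true and half false are the two entries under [4] ≅ {±1}²; opposite negates both of them.
half : Bool → Fin 4 → Bool
half true  zero             = true
half true  (suc zero)       = true
half true  (suc (suc _))    = false
half false zero             = true
half false (suc zero)       = false
half false (suc (suc zero)) = true
half false (suc (suc (suc _))) = false

pair : Bool → Bool → Fin 4
pair true  true  = zero
pair true  false = suc zero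
pair false true  = suc (suc zero)
pair false false = suc (suc (suc zero))

half-true : ∀ σ a b → half true (tttAct 4 σ (pair a b)) ≡ grAct σ a
half-true false true  true  = refl
half-true false true  false = refl
half-true false false true  = refl
half-true false false false = refl
half-true true  true  true  = refl
half-true true  true  false = refl
half-true true  false true  = refl
half-true true  false false = refl

half-false : ∀ σ a b → half false (tttAct 4 σ (pair a b)) ≡ grAct σ b
half-false false true  true  = refl
half-false false true  false = refl
half-false false false true  = refl
half-false false false false = refl
half-false true  true  true  = refl
half-false true  true  false = refl
half-false true  false true  = refl
half-false true  false false = refl

-- If variable `j` did not occur, changing entry `j` would not change the image, against
-- injectivity.
paramMap-onto : ∀ {n k} {s : Fin n → CoordSpec (Fin 4) Bool k} → IsParamMap (tttAct 4) s →
                ∀ j → ∃₂ λ i σ → s i ≡ var j σ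
paramMap-onto {k = k} {s} param j with Fin.any? (λ i → usesVar? (s i))
  where
  usesVar? : ∀ e → Dec (∃ λ σ → e ≡ var j σ)
  usesVar? (const _) = no λ ()
  usesVar? (var i σ) with i Fin.≟ j
  ... | yes refl = yes (σ , refl)
  ... | no  i≢j  = no λ { (_ , refl) → i≢j refl }
... | yes found = found
... | no unused = contradiction
    (trans (sym (lookup-replicate j zero))
      (trans (cong (λ x → lookup x j) (param x y same)) (lookup∘update j x (suc zero))))
    λ ()
  where
  x y : Vec (Fin 4) k
  x = replicate k zero
  y = x [ j ]≔ suc zero
  coord : ∀ i e → s i ≡ e → evalCoord (tttAct 4) e x ≡ evalCoord (tttAct 4) e y
  coord i (const _) eq = refl
  coord i (var h σ) eq = cong (tttAct 4 σ)
    (sym (lookup∘update′ (λ h≡j → unused (i , σ , trans eq (cong (λ h → var h σ) h≡j))) x (suc zero)))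
  same : embed (tttAct 4) s x ≡ embed (tttAct 4) s y
  same = tabulate-cong λ i → coord i (s i) refl

-- point s true and point s false parametrise the top and the bottom cube.
project : ∀ {k} → Bool → CoordSpec (Fin 4) Bool k → Vec Bool k → Bool
project a (const q) u = half a q
project a (var j σ) u = grAct σ (lookup u j)

point : ∀ {n k} → (Fin n → CoordSpec (Fin 4) Bool k) → Bool → Vec Bool k → Vec Bool (suc n)
point s a u = a ∷ tabulate λ i → project a (s i) u

halves : ∀ {n k} (s : Fin n → CoordSpec (Fin 4) Bool k) a w u →
  (∀ σ j → half a (tttAct 4 σ (lookup w j)) ≡ grAct σ (lookup u j)) →
  a ∷ map (half a) (embed (tttAct 4) s w) ≡ point s a u
halves s a w u eq = cong (a ∷_) (trans (sym (tabulate-∘ (half a) _)) (tabulate-cong λ i → coord (s i)))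
  where
  coord : ∀ e → half a (evalCoord (tttAct 4) e w) ≡ project a e u
  coord (const q) = refl
  coord (var j σ) = eq σ j

-- Edge classes

cell : Bool → Trit → Bool → Bool
cell a 0ᵗ b = b
cell a +ᵗ b = a
cell a -ᵗ b = not a

-- The two values of `a` give the ends of an edge of class `p`; `z` fixes the coordinates off the
-- support.
segment : ∀ {k} → Vec Trit k → Vec Bool k → Bool → Vec Bool k
segment p z a = zipWith (cell a) p z

segment-neg : ∀ {k} (p : Vec Trit k) z a → segment (map neg p) z a ≡ segment p z (not a)
segment-neg []      []      a = refl
segment-neg (t ∷ p) (b ∷ z) a = cong₂ _∷_ (lem t) (segment-neg p z a)
  where
  lem : ∀ t → cell a (neg t) b ≡ cell (not a) t b
  lem 0ᵗ = refl
  lem +ᵗ = refl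
  lem -ᵗ = sym (Bool.not-involutive a)

spot : ∀ {k} → Vec Bool k → Maybe (Fin k × Bool) → Bool → Bool
spot x nothing        b = b
-- In a frame `true` is the sign +, whereas `grAct true` negates.
spot x (just (j , s)) b = grAct (not s) (lookup x j)

place : ∀ {k n} → Frame k n → Vec Bool n → Vec Bool k → Vec Bool n
place M z x = zipWith (spot x) M z

-- `place` sends edges of class `w` to edges of class `M · w`, so the four vectors of a line are the
-- classes of the edges of a square.
place-segment : ∀ {k n} (M : Frame k n) z (w : Vec Trit k) r a →
                place M z (segment w r a) ≡ segment (M · w) (place M z r) a
place-segment []      []      w r a = refl
place-segment (e ∷ M) (b ∷ z) w r a = cong₂ _∷_ (lem e) (place-segment M z w r a)
  where
  grAct-cell : ∀ s t b → grAct (not s) (cell a t b) ≡ cell a (signed s t) (grAct (not s) b)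
  grAct-cell true  t b = refl
  grAct-cell false 0ᵗ b = refl
  grAct-cell false +ᵗ b = refl
  grAct-cell false -ᵗ b = Bool.not-involutive a
  lem : ∀ e → spot (segment w r a) e b ≡ cell a (entry w e) (spot r e b)
  lem nothing        = refl
  lem (just (j , s)) = trans (cong (grAct (not s)) (lookup-zipWith (cell a) j w r)) (grAct-cell s _ _)

-- Any two points of the square are the ends of an edge in one of the four classes.
separate : ∀ x y → x ≢ y →
  ∃ λ w → w ∈ directions × ∃₂ λ r a → x ≡ segment w r a × y ≡ segment w r (not a)
separate (a ∷ b ∷ []) (a′ ∷ b′ ∷ []) x≢y with a′ Bool.≟ a | b′ Bool.≟ b
... | yes refl | yes refl = contradiction refl x≢y
... | yes refl | no b′≢b  = _ , there (here refl) , (a ∷ b ∷ []) , b , refl ,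
  cong (λ c → a ∷ c ∷ []) (Bool.¬-not b′≢b)
... | no a′≢a  | yes refl = _ , here refl , (a ∷ b ∷ []) , a , refl ,
  cong (λ c → c ∷ b ∷ []) (Bool.¬-not a′≢a)
... | no a′≢a  | no b′≢b with b Bool.≟ a
...   | yes refl = _ , there (there (here refl)) , (a ∷ a ∷ []) , a , refl ,
        cong₂ (λ c d → c ∷ d ∷ []) (Bool.¬-not a′≢a) (Bool.¬-not b′≢b)
...   | no b≢a   = _ , there (there (there (here refl))) , (a ∷ b ∷ []) , a ,
        cong (λ d → a ∷ d ∷ []) (Bool.¬-not b≢a) ,
        cong₂ (λ c d → c ∷ d ∷ []) (Bool.¬-not a′≢a) (trans (Bool.¬-not b′≢b) (cong not (Bool.¬-not b≢a)))

other : Fin 2 → Fin 2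
other zero       = suc zero
other (suc zero) = zero

≢⇒≡other : ∀ {a b : Fin 2} → a ≢ b → a ≡ other b
≢⇒≡other {zero}     {zero}     ne = contradiction refl ne
≢⇒≡other {zero}     {suc zero} ne = refl
≢⇒≡other {suc zero} {zero}     ne = refl
≢⇒≡other {suc zero} {suc zero} ne = contradiction refl ne

direction-nonzero : ∀ {k} (M : Frame 2 k) → Onto M →
                    ∀ {w} → w ∈ directions → ∃ λ i → lookup (M · w) i ≢ 0ᵗ
direction-nonzero M onto {w} w∈ = proj₁ (onto (proj₁ (nonzero w∈))) , λ eq →
  let j , wj≢o = nonzero w∈
      i , s , Mi = onto j
  in wj≢o (signed-o s (trans (sym (trans (lookup-map i (entry w) M) (cong (entry w) Mi))) eq))
  where
  nonzero : ∀ {w} → w ∈ directions → ∃ λ j → lookup w j ≢ 0ᵗ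
  nonzero (here refl)                         = zero , λ ()
  nonzero (there (here refl))                 = suc zero , λ ()
  nonzero (there (there (here refl)))         = zero , λ ()
  nonzero (there (there (there (here refl)))) = zero , λ ()
  signed-o : ∀ s {t} → signed s t ≡ 0ᵗ → t ≡ 0ᵗ
  signed-o true      eq = eq
  signed-o false {0ᵗ} eq = refl

-- Squares from two parallel cubes

module ParallelCubes {n k}
  (c : Vec Bool (suc n) → Vec Bool (suc n) → Fin 2) (c-sym : ∀ u v → c u v ≡ c v u)
  (s : Fin n → CoordSpec (Fin 4) Bool k) (s-onto : ∀ j → ∃₂ λ i σ → s i ≡ var j σ)
  (col : Fin 2) (cross : ∀ u v → c (point s true u) (point s false v) ≡ col)
  where

  edge : Bool → Vec Trit k → Vec Bool k → Fin 2
  edge a p z = c (point s a (segment p z true)) (point s a (segment p z false))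

  edge-sym : ∀ a p z b → c (point s a (segment p z b)) (point s a (segment p z (not b))) ≡ edge a p z
  edge-sym a p z true  = refl
  edge-sym a p z false = c-sym _ _

  HasEdge : Bool → Vec Trit k → Set
  HasEdge a p = ∃ λ z → edge a p z ≡ col

  hasEdge? : ∀ a p → Dec (HasEdge a p)
  hasEdge? a p = search-Vec k search-Bool λ z → edge a p z Fin.≟ col

  lookup-point : ∀ a u i j σ → s i ≡ var j σ → lookup (point s a u) (suc i) ≡ grAct σ (lookup u j)
  lookup-point a u i j σ eq = trans (lookup∘tabulate _ i) (cong (λ e → project a e u) eq)

  grAct-grAct : ∀ σ t → ∃ λ ρ → ∀ b → grAct σ (grAct t b) ≡ grAct ρ b
  grAct-grAct false t     = t , λ _ → refl
  grAct-grAct true  false = true , λ _ → refl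
  grAct-grAct true  true  = false , Bool.not-involutive

  -- All six edges of a square along `M` belong to classes without an edge of colour `col`, so all
  -- have the other colour, whatever the base point.
  flat : ∀ a (M : Frame 2 k) → Onto M →
         (∀ {w} → w ∈ directions → ¬ HasEdge a (M · w)) → MonochromaticSquare c
  flat a M onto none = monochromatic {c = c} subsquare (other col) mono
    where
    z = replicate k false
    F : Vec Bool 2 → Vec Bool (suc n)
    F x = point s a (place M z x)
    coord : ∀ e → ∃ λ sp → ∀ x → project a e (place M z x) ≡ evalCoord grAct sp x
    coord (const q) = const (half a q) , λ _ → refl
    coord (var j σ) with lookup M j in eq
    ... | nothing = const (grAct σ (lookup z j)) , λ x → cong (grAct σ)
          (trans (lookup-zipWith (spot x) j M z) (cong (λ e → spot x e (lookup z j)) eq))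
    ... | just (i , t) = let sp , val = unary (grAct σ ∘ grAct (not t)) i in
          sp , λ x → trans (cong (grAct σ)
            (trans (lookup-zipWith (spot x) j M z) (cong (λ e → spot x e (lookup z j)) eq))) (val x)
    subsquare : Subsquare F
    Subsquare.coordinate subsquare zero    = const a , λ _ → refl
    Subsquare.coordinate subsquare (suc i) = let sp , val = coord (s i) in
      sp , λ x → trans (lookup∘tabulate _ i) (val x)
    Subsquare.parameter subsquare j =
      let i , t , Mi = onto j
          h , σ , sh = s-onto i
          ρ , act    = grAct-grAct σ (not t)
      in suc h , ρ , λ x → trans (lookup-point a (place M z x) h i σ sh)
           (trans (cong (grAct σ) (trans (lookup-zipWith (spot x) i M z) (cong (λ e → spot x e (lookup z i)) Mi)))
             (act (lookup x j)))
    mono : ∀ x y → x ≢ y → c (F x) (F y) ≡ other col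
    mono x y x≢y with w , w∈ , r , b , refl , refl ← separate x y x≢y =
      ≢⇒≡other λ eq → none w∈ (place M z r , trans (sym (trans
        (cong₂ (λ u v → c (point s a u) (point s a v)) (place-segment M z w r b) (place-segment M z w r (not b)))
        (edge-sym a (M · w) (place M z r) b))) eq)

  -- Edges of one class are parallel, even if `z⁺` and `z⁻` differ: the first parameter switches
  -- cube and base point, the second runs along the edge, and each coordinate depends on only one of
  -- them.
  mixed : ∀ p → (∃ λ i → lookup p i ≢ 0ᵗ) → HasEdge true p → HasEdge false p →
          MonochromaticSquare c
  mixed p (i₀ , pi≢o) (z⁺ , e⁺) (z⁻ , e⁻) = monochromatic {c = c} subsquare col mono
    where
    z : Bool → Vec Bool k
    z true  = z⁺
    z false = z⁻
    edges : ∀ a → edge a p (z a) ≡ col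
    edges true  = e⁺
    edges false = e⁻
    F : Vec Bool 2 → Vec Bool (suc n)
    F (a ∷ b ∷ []) = point s a (segment p (z a) b)
    Unary : (Bool → Bool → Bool) → Set
    Unary f = ∃ λ sp → ∀ a b → f a b ≡ evalCoord grAct sp (a ∷ b ∷ [])
    unary₀ : ∀ g → Unary (λ a b → g a)
    unary₀ g = let sp , val = unary g zero in sp , λ a b → val (a ∷ b ∷ [])
    unary₁ : ∀ g → Unary (λ a b → g b)
    unary₁ g = let sp , val = unary g (suc zero) in sp , λ a b → val (a ∷ b ∷ [])
    lookup-segment : ∀ a b j t → lookup p j ≡ t → lookup (segment p (z a) b) j ≡ cell b t (lookup (z a) j)
    lookup-segment a b j t eq =
      trans (lookup-zipWith (cell b) j p (z a)) (cong (λ t → cell b t (lookup (z a) j)) eq)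
    coord : ∀ e → Unary (λ a b → project a e (segment p (z a) b))
    coord (const q) = unary₀ λ a → half a q
    coord (var j σ) with lookup p j in eq
    ... | 0ᵗ = let sp , val = unary₀ (λ a → grAct σ (lookup (z a) j)) in
              sp , λ a b → trans (cong (grAct σ) (lookup-segment a b j 0ᵗ eq)) (val a b)
    ... | +ᵗ = let sp , val = unary₁ (grAct σ) in
              sp , λ a b → trans (cong (grAct σ) (lookup-segment a b j +ᵗ eq)) (val a b)
    ... | -ᵗ = let sp , val = unary₁ (grAct σ ∘ not) in
              sp , λ a b → trans (cong (grAct σ) (lookup-segment a b j -ᵗ eq)) (val a b)
    sign : ∀ t → t ≢ 0ᵗ → ∃ λ τ → ∀ b d → cell b t d ≡ grAct τ b
    sign 0ᵗ t≢o = contradiction refl t≢o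
    sign +ᵗ _   = false , λ _ _ → refl
    sign -ᵗ _   = true  , λ _ _ → refl
    subsquare : Subsquare F
    Subsquare.coordinate subsquare zero    = var zero false , λ { (a ∷ b ∷ []) → refl }
    Subsquare.coordinate subsquare (suc i) = let sp , val = coord (s i) in
      sp , λ { (a ∷ b ∷ []) → trans (lookup∘tabulate _ i) (val a b) }
    Subsquare.parameter subsquare zero       = zero , false , λ { (a ∷ b ∷ []) → refl }
    Subsquare.parameter subsquare (suc zero) =
      let h , σ , sh = s-onto i₀
          τ , val    = sign (lookup p i₀) pi≢o
          ρ , act    = grAct-grAct σ τ
      in suc h , ρ , λ { (a ∷ b ∷ []) → trans (lookup-point a (segment p (z a) b) h i₀ σ sh)
           (trans (cong (grAct σ) (trans (lookup-segment a b i₀ _ refl) (val b _))) (act b)) }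
    mono : ∀ x y → x ≢ y → c (F x) (F y) ≡ col
    mono (true  ∷ b ∷ []) (false ∷ d ∷ []) _ = cross _ _
    mono (false ∷ b ∷ []) (true  ∷ d ∷ []) _ = trans (c-sym _ _) (cross _ _)
    mono (true  ∷ b ∷ []) (true  ∷ d ∷ []) x≢y with refl ← Bool.¬-not {d} {b} (λ { refl → x≢y refl }) =
      trans (edge-sym true p z⁺ b) e⁺
    mono (false ∷ b ∷ []) (false ∷ d ∷ []) x≢y with refl ← Bool.¬-not {d} {b} (λ { refl → x≢y refl }) =
      trans (edge-sym false p z⁻ b) e⁻

  χ : Colouring k
  χ p = does (hasEdge? true p)

  χ-true : ∀ {p} → χ p ≡ true → HasEdge true p
  χ-true {p} eq with hasEdge? true p
  ... | yes has = has

  χ-false : ∀ {p} → χ p ≡ false → ¬ HasEdge true p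
  χ-false {p} eq with hasEdge? true p
  ... | no none = none

  HasEdge-neg : ∀ a p → HasEdge a (map neg p) → HasEdge a p
  HasEdge-neg a p (z , eq) = z , trans (c-sym _ _) (trans
    (sym (cong₂ (λ u v → c (point s a u) (point s a v)) (segment-neg p z true) (segment-neg p z false))) eq)

  neg-involutive : ∀ {m} (p : Vec Trit m) → map neg (map neg p) ≡ p
  neg-involutive [] = refl
  neg-involutive (0ᵗ ∷ p) = cong (0ᵗ ∷_) (neg-involutive p)
  neg-involutive (+ᵗ ∷ p) = cong (+ᵗ ∷_) (neg-involutive p)
  neg-involutive (-ᵗ ∷ p) = cong (-ᵗ ∷_) (neg-involutive p)

  χ-even : ∀ p → χ (map neg p) ≡ χ p
  χ-even p with hasEdge? true (map neg p) | hasEdge? true p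
  ... | yes _   | yes _   = refl
  ... | no _    | no _    = refl
  ... | yes has | no none = contradiction (HasEdge-neg true p has) none
  ... | no none | yes has = contradiction
    (HasEdge-neg true (map neg p) (subst (HasEdge true) (sym (neg-involutive p)) has)) none

  MonochromaticLine : Frame 2 k → Bool → Set
  MonochromaticLine M b = Onto M × All (Holds (χ ∘ (M ·_))) (square b)

  line⇒square : ∀ M b → MonochromaticLine M b → MonochromaticSquare c
  line⇒square M false (onto , p ∷ q ∷ r ∷ t ∷ []) = flat true M onto (All.lookup none)
    where
    none : All (λ w → ¬ HasEdge true (M · w)) directions
    none = χ-false p ∷ χ-false q ∷ χ-false r ∷ χ-false t ∷ []
  -- All four classes have an edge of colour `col` at the top, so a bottom edge of that colour in
  -- any of them can be matched.
  line⇒square M true (onto , p ∷ q ∷ r ∷ t ∷ []) with any? (λ w → hasEdge? false (M · w)) directions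
  ... | no  none  = flat false M onto (All.lookup (¬Any⇒All¬ directions none))
  ... | yes found = let w , w∈ , has = find found in
    mixed (M · w) (direction-nonzero M onto w∈) (All.lookup edges w∈) has
    where
    edges : All (λ w → HasEdge true (M · w)) directions
    edges = χ-true p ∷ χ-true q ∷ χ-true r ∷ χ-true t ∷ []

  -- `Valid []` only refutes the absence of lines; searching the finitely many frames produces an
  -- actual line.
  monochromaticLine? : Dec (∃₂ MonochromaticLine)
  monochromaticLine? =
    search-Vec k (search-Maybe (search-× Fin.any? search-Bool)) λ M → search-Bool λ b →
      onto? M ×-dec All.all? (λ l → χ (M · proj₁ l) Bool.≟ proj₂ l) (square b)

  monochromaticSquare : Valid {k} [] → MonochromaticSquare c
  monochromaticSquare valid with monochromaticLine?
  ... | yes (M , b , mono) = line⇒square M b mono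
  ... | no none = ⊥-elim (valid χ (record
    { even = χ-even ; line = λ M onto b mono → none (M , b , onto , mono) }) [])

-- From tic-tac-toe spaces to edge colourings

TTT⇒Gr : Valid {6} [] → ∀ n → TTTProp 4 2 6 n → GrProp 2 (suc n)
TTT⇒Gr valid n ttt c c-sym =
  let s , param , col , mono = ttt λ x → c (true ∷ map (half true) x) (false ∷ map (half false) x)
      cross : ∀ u v → c (point s true u) (point s false v) ≡ col
      -- Pairing `u` and `v` entrywise gives parameters of a point of the space whose halves lie
      -- over `u` and `v`, so every edge between the cubes is reached.
      cross u v = trans (sym (cong₂ c
        (halves s true (zipWith pair u v) u λ σ j →
          trans (cong (half true ∘ tttAct 4 σ) (lookup-zipWith pair j u v)) (half-true σ _ _))
        (halves s false (zipWith pair u v) v λ σ j →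
          trans (cong (half false ∘ tttAct 4 σ) (lookup-zipWith pair j u v)) (half-false σ _ _))))
        (mono (zipWith pair u v))
  in ParallelCubes.monochromaticSquare c c-sym s (paramMap-onto param) col cross valid

theorem1p3 : (g t : ℕ) → IsLeast (GrProp 2) g → IsLeast (TTTProp 4 2 6) t → g ≤ t + 1
theorem1p3 g t (_ , least) (ttt , _) =
  subst (g ≤_) (+-comm 1 t) (least (suc t) (TTT⇒Gr noGoodColouring t ttt))
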